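{- Let $\mathscr{R}$ be the set of inference rules consisting of axiom, symmetric cut, and split. Let $\mathscr{H}$ be a set of formulas (the hypotheses) and let $A$ be a formula (the goal). If there is a circular proof of $A$ from $\mathscr{H}$ through the rules in $\mathscr{R}$, then every truth assignment that satisfies every formula in $\mathscr{H}$ also satisfies $A$.
   Context: Formulas. A literal is a propositional variable $X$ or its negation $\overline{X}$. Formulas are in negation normal form: built from literals by disjunction and conjunction. Both $\vee$ and $\wedge$ are treated as associative, commutative and idempotent (i.e. as operations on finite sets of formulas); the empty disjunction $0$ is always false and neutral for $\vee$, and the empty conjunction $1$ is always true and neutral for $\wedge$. The dual $\overline{A}$ of $A$ is defined by: $\overline{A}$ is the complementary literal if $A$ is a literal, $\overline{B\vee C}=\overline{B}\wedge\overline{C}$, $\overline{B\wedge C}=\overline{B}\vee\overline{C}$ (so $\overline{0}=1$). Truth assignments evaluate formulas as usual. Rules, for arbitrary formulas $A,C$: axiom (no premises, conclusion $A\vee\overline{A}$); symmetric cut (premises $C\vee A$ and $C\vee\overline{A}$, conclusion $C$); split (premise $C$, two conclusions $C\vee A$ and $C\vee\overline{A}$). Circular proofs. A circular pre-proof $\Pi$ over a set of inference rules is a finite directed bipartite graph $G(\Pi)$ with two types of vertices, formula-vertices (set $J$) and inference-vertices (set $I$), every edge going between the two types. Each formula-vertex is labelled by a formula (different vertices may carry the same formula). Each inference-vertex is labelled by an instance of a rule whose premises are the formulas labelling its in-neighbours and whose conclusions are the formulas labelling its out-neighbours (one in-neighbour per premise, one out-neighbour per conclusion). Cycles are allowed.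 $N^-(u)$ and $N^+(u)$ denote the sets of in- and out-neighbours of $u$. A flow assignment is a map $F:I\to\mathbb{R}^+$ to the positive reals. The balance of $u\in J$ is $B(u)=\sum_{w\in N^-(u)}F(w)-\sum_{w\in N^+(u)}F(w)$. Formula-vertices with $B(u)<0$ are sources of $G(\Pi,F)$ and those with $B(u)>0$ are sinks. $F$ witnesses a proof of $A$ from $\mathscr{H}$ if every source is labelled by a formula in $\mathscr{H}$ and some sink is labelled by $A$. A circular proof of $A$ from $\mathscr{H}$ is a circular pre-proof for which there exists a flow assignment witnessing a proof of $A$ from $\mathscr{H}$. -}

module Defs where

open import Algebra.Bundles using (CommutativeMonoid)
open import Data.Bool.Base as Bool using (Bool; true; false)
import Data.Bool.Properties as Bool
open import Data.Fin.Base using (Fin)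
open import Data.List.Base using (List; []; _∷_; map; foldr; filterᵇ; allFin)
import Data.List.Relation.Binary.Permutation.Setoid as Permutation
open import Data.Nat.Base as ℕ using (ℕ)
import Data.Nat.Properties as ℕ
open import Data.Product.Base using (Σ; ∃; ∃-syntax; _×_; _,_)
open import Data.Rational.Base as ℚ using (ℚ; 0ℚ; ½; ∣_∣)
import Data.Rational.Properties as ℚ
open import Level using (Level; 0ℓ)
open import Relation.Binary.Bundles using (Setoid)
open import Relation.Binary.PropositionalEquality.Core
  using (_≡_; refl; sym; trans; cong; cong₂; subst)
open import Relation.Unary using (Pred; _∈_)

private variable
  ℓ : Level

-- Real numbers, as Cauchy sequences of rationals.  Only 0, addition,
-- subtraction and the order are needed; each is the usual operation on
-- representatives, and the order identifies equivalent sequences.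

record ℝ : Set where
  field
    seq    : ℕ → ℚ
    cauchy : ∀ ε → 0ℚ ℚ.< ε →
             ∃[ N ] ∀ m n → N ℕ.≤ m → N ℕ.≤ n → ∣ seq m ℚ.- seq n ∣ ℚ.< ε

open ℝ public

private
  half-pos : ∀ {ε} → 0ℚ ℚ.< ε → 0ℚ ℚ.< ½ ℚ.* ε
  half-pos {ε} 0<ε = ℚ.positive⁻¹ (½ ℚ.* ε)
    where
    instance
      ε-pos : ℚ.Positive ε
      ε-pos = ℚ.positive 0<ε
      ½ε-pos : ℚ.Positive (½ ℚ.* ε)
      ½ε-pos = ℚ.pos*pos⇒pos ½ ε

  half+half : ∀ ε → ½ ℚ.* ε ℚ.+ ½ ℚ.* ε ≡ ε
  half+half ε = trans (sym (ℚ.*-distribʳ-+ ε ½ ½)) (ℚ.*-identityˡ ε)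

  medial : ∀ a b c d →
           (a ℚ.+ b) ℚ.- (c ℚ.+ d) ≡ (a ℚ.- c) ℚ.+ (b ℚ.- d)
  medial a b c d = trans (cong ((a ℚ.+ b) ℚ.+_) (ℚ.neg-distrib-+ c d))
                         (interchange a b (ℚ.- c) (ℚ.- d))
    where
    open import Algebra.Properties.CommutativeSemigroup
      (CommutativeMonoid.commutativeSemigroup ℚ.+-0-commutativeMonoid)

infixl 6 _+ℝ_ _-ℝ_
infix  8 -ℝ_
infix  4 _<ℝ_

0ℝ : ℝ
0ℝ .seq _ = 0ℚ
0ℝ .cauchy ε 0<ε = 0 , λ _ _ _ _ → 0<ε

_+ℝ_ : ℝ → ℝ → ℝ
(x +ℝ y) .seq n = seq x n ℚ.+ seq y n
(x +ℝ y) .cauchy ε 0<ε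
  with M , x-close ← cauchy x (½ ℚ.* ε) (half-pos 0<ε)
     | N , y-close ← cauchy y (½ ℚ.* ε) (half-pos 0<ε)
  = M ℕ.⊔ N , λ m n ≤m ≤n →
      subst (ℚ._< ε)
        (cong ∣_∣ (sym (medial (seq x m) (seq y m) (seq x n) (seq y n))))
        (ℚ.≤-<-trans
          (ℚ.∣p+q∣≤∣p∣+∣q∣ (seq x m ℚ.- seq x n) (seq y m ℚ.- seq y n))
          (subst (_ ℚ.<_) (half+half ε)
            (ℚ.+-mono-<
              (x-close m n (ℕ.m⊔n≤o⇒m≤o M N ≤m) (ℕ.m⊔n≤o⇒m≤o M N ≤n))
              (y-close m n (ℕ.m⊔n≤o⇒n≤o M N ≤m) (ℕ.m⊔n≤o⇒n≤o M N ≤n)))))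

-ℝ_ : ℝ → ℝ
(-ℝ x) .seq n = ℚ.- seq x n
(-ℝ x) .cauchy ε 0<ε with N , x-close ← cauchy x ε 0<ε =
  N , λ m n ≤m ≤n →
    subst (ℚ._< ε)
      (trans (sym (ℚ.∣-p∣≡∣p∣ (seq x m ℚ.- seq x n)))
             (cong ∣_∣ (ℚ.neg-distrib-+ (seq x m) (ℚ.- seq x n))))
      (x-close m n ≤m ≤n)

_-ℝ_ : ℝ → ℝ → ℝ
x -ℝ y = x +ℝ (-ℝ y)

_<ℝ_ : ℝ → ℝ → Set
x <ℝ y = ∃[ ε ] 0ℚ ℚ.< ε × ∃[ N ] ∀ n → N ℕ.≤ n → seq x n ℚ.+ ε ℚ.≤ seq y n

sumℝ : List ℝ → ℝ
sumℝ = foldr _+ℝ_ 0ℝ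

data Literal (Var : Set) : Set where
  pos neg : Var → Literal Var

infixr 7 _∧_
infixr 6 _∨_
infix  4 _≈_

data Formula (Var : Set) : Set where
  lit     : Literal Var → Formula Var
  𝟘 𝟙     : Formula Var
  _∨_ _∧_ : Formula Var → Formula Var → Formula Var

-- Formulas are identified modulo the following congruence, which makes
-- ∨ and ∧ operations on finite sets, with 𝟘 and 𝟙 as the empty cases.

data _≈_ {Var : Set} : Formula Var → Formula Var → Set where
  ≈-refl  : ∀ {A} → A ≈ A
  ≈-sym   : ∀ {A B} → A ≈ B → B ≈ A
  ≈-trans : ∀ {A B C} → A ≈ B → B ≈ C → A ≈ C
  ∨-cong  : ∀ {A A′ B B′} → A ≈ A′ → B ≈ B′ → A ∨ B ≈ A′ ∨ B′
  ∧-cong  : ∀ {A A′ B B′} → A ≈ A′ → B ≈ B′ → A ∧ B ≈ A′ ∧ B′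
  ∨-assoc : ∀ A B C → (A ∨ B) ∨ C ≈ A ∨ (B ∨ C)
  ∧-assoc : ∀ A B C → (A ∧ B) ∧ C ≈ A ∧ (B ∧ C)
  ∨-comm  : ∀ A B → A ∨ B ≈ B ∨ A
  ∧-comm  : ∀ A B → A ∧ B ≈ B ∧ A
  ∨-idem  : ∀ A → A ∨ A ≈ A
  ∧-idem  : ∀ A → A ∧ A ≈ A
  ∨-identity : ∀ A → 𝟘 ∨ A ≈ A
  ∧-identity : ∀ A → 𝟙 ∧ A ≈ A

formulaSetoid : Set → Setoid 0ℓ 0ℓ
formulaSetoid Var = record
  { Carrier       = Formula Var
  ; _≈_           = _≈_
  ; isEquivalence = record { refl = ≈-refl ; sym = ≈-sym ; trans = ≈-trans }
  }

infix 4 _↭_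

_↭_ : {Var : Set} → List (Formula Var) → List (Formula Var) → Set
_↭_ {Var} = Permutation._↭_ (formulaSetoid Var)

-- Membership in the set of formulas (modulo ≈) represented by H.

infix 4 _∈≈_

_∈≈_ : {Var : Set} → Formula Var → Pred (Formula Var) ℓ → Set ℓ
A ∈≈ H = ∃[ B ] B ∈ H × A ≈ B

complement : {Var : Set} → Literal Var → Literal Var
complement (pos X) = neg X
complement (neg X) = pos X

dual : {Var : Set} → Formula Var → Formula Var
dual (lit l) = lit (complement l)
dual 𝟘       = 𝟙
dual 𝟙       = 𝟘
dual (A ∨ B) = dual A ∧ dual B
dual (A ∧ B) = dual A ∨ dual B

dual-cong : {Var : Set} {A B : Formula Var} → A ≈ B → dual A ≈ dual B
dual-cong ≈-refl         = ≈-refl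
dual-cong (≈-sym p)      = ≈-sym (dual-cong p)
dual-cong (≈-trans p q)  = ≈-trans (dual-cong p) (dual-cong q)
dual-cong (∨-cong p q)   = ∧-cong (dual-cong p) (dual-cong q)
dual-cong (∧-cong p q)   = ∨-cong (dual-cong p) (dual-cong q)
dual-cong (∨-assoc A B C) = ∧-assoc (dual A) (dual B) (dual C)
dual-cong (∧-assoc A B C) = ∨-assoc (dual A) (dual B) (dual C)
dual-cong (∨-comm A B)   = ∧-comm (dual A) (dual B)
dual-cong (∧-comm A B)   = ∨-comm (dual A) (dual B)
dual-cong (∨-idem A)     = ∧-idem (dual A)
dual-cong (∧-idem A)     = ∨-idem (dual A)
dual-cong (∨-identity A) = ∧-identity (dual A)
dual-cong (∧-identity A) = ∨-identity (dual A)

Assignment : Set → Set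
Assignment Var = Var → Bool

evalLiteral : {Var : Set} → Assignment Var → Literal Var → Bool
evalLiteral α (pos X) = α X
evalLiteral α (neg X) = Bool.not (α X)

eval : {Var : Set} → Assignment Var → Formula Var → Bool
eval α (lit l) = evalLiteral α l
eval α 𝟘       = false
eval α 𝟙       = true
eval α (A ∨ B) = eval α A Bool.∨ eval α B
eval α (A ∧ B) = eval α A Bool.∧ eval α B

infix 4 _⊨_

_⊨_ : {Var : Set} → Assignment Var → Formula Var → Set
α ⊨ A = eval α A ≡ true

eval-cong : {Var : Set} (α : Assignment Var) {A B : Formula Var} →
            A ≈ B → eval α A ≡ eval α B
eval-cong α ≈-refl           = refl
eval-cong α (≈-sym p)        = sym (eval-cong α p)
eval-cong α (≈-trans p q)    = trans (eval-cong α p) (eval-cong α q)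
eval-cong α (∨-cong p q)     = cong₂ Bool._∨_ (eval-cong α p) (eval-cong α q)
eval-cong α (∧-cong p q)     = cong₂ Bool._∧_ (eval-cong α p) (eval-cong α q)
eval-cong α (∨-assoc A B C)  = Bool.∨-assoc (eval α A) (eval α B) (eval α C)
eval-cong α (∧-assoc A B C)  = Bool.∧-assoc (eval α A) (eval α B) (eval α C)
eval-cong α (∨-comm A B)     = Bool.∨-comm (eval α A) (eval α B)
eval-cong α (∧-comm A B)     = Bool.∧-comm (eval α A) (eval α B)
eval-cong α (∨-idem A)       = Bool.∨-idem (eval α A)
eval-cong α (∧-idem A)       = Bool.∧-idem (eval α A)
eval-cong α (∨-identity A)   = refl
eval-cong α (∧-identity A)   = refl

record RuleSet (Var : Set) : Set₁ where
  field
    Instance    : Set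
    premises    : Instance → List (Formula Var)
    conclusions : Instance → List (Formula Var)

data ℛ-Instance (Var : Set) : Set where
  axiom        : (A : Formula Var)   → ℛ-Instance Var
  symmetricCut : (C A : Formula Var) → ℛ-Instance Var
  split        : (C A : Formula Var) → ℛ-Instance Var

ℛ : (Var : Set) → RuleSet Var
ℛ Var = record
  { Instance    = ℛ-Instance Var
  ; premises    = λ where
      (axiom A)          → []
      (symmetricCut C A) → C ∨ A ∷ C ∨ dual A ∷ []
      (split C A)        → C ∷ []
  ; conclusions = λ where
      (axiom A)          → A ∨ dual A ∷ []
      (symmetricCut C A) → C ∷ []
      (split C A)        → C ∨ A ∷ C ∨ dual A ∷ []
  }

record BipartiteDigraph : Set where
  field
    #J #I : ℕ

  J : Set
  J = Fin #J

  I : Set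
  I = Fin #I

  -- edgeᴶᴵ u w says that u → w is an edge; edgeᴵᴶ w u that w → u is one.
  field
    edgeᴶᴵ : J → I → Bool
    edgeᴵᴶ : I → J → Bool

  N⁻ᴶ N⁺ᴶ : J → List I
  N⁻ᴶ u = filterᵇ (λ w → edgeᴵᴶ w u) (allFin #I)
  N⁺ᴶ u = filterᵇ (λ w → edgeᴶᴵ u w) (allFin #I)

  N⁻ᴵ N⁺ᴵ : I → List J
  N⁻ᴵ w = filterᵇ (λ u → edgeᴶᴵ u w) (allFin #J)
  N⁺ᴵ w = filterᵇ (λ u → edgeᴵᴶ w u) (allFin #J)

record PreProof {Var : Set} (R : RuleSet Var) : Set where
  open RuleSet R
  field
    graph : BipartiteDigraph

  open BipartiteDigraph graph public

  -- The neighbour lists have no repetitions, so the permutations are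
  -- bijections of neighbours with premises, resp. conclusions.
  field
    formula    : J → Formula Var
    rule       : I → Instance
    in-labels  : ∀ w → map formula (N⁻ᴵ w) ↭ premises (rule w)
    out-labels : ∀ w → map formula (N⁺ᴵ w) ↭ conclusions (rule w)

module _ {Var : Set} {R : RuleSet Var} (Π : PreProof R) where
  open PreProof Π

  record FlowAssignment : Set where
    field
      flow     : I → ℝ
      positive : ∀ w → 0ℝ <ℝ flow w

  module _ (F : FlowAssignment) where
    open FlowAssignment F

    balance : J → ℝ
    balance u = sumℝ (map flow (N⁻ᴶ u)) -ℝ sumℝ (map flow (N⁺ᴶ u))

    IsSource IsSink : J → Set
    IsSource u = balance u <ℝ 0ℝ
    IsSink   u = 0ℝ <ℝ balance u

    Witnesses : Pred (Formula Var) ℓ → Formula Var → Set ℓ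
    Witnesses H A = (∀ u → IsSource u → formula u ∈≈ H)
                  × (∃[ u ] IsSink u × formula u ≈ A)

CircularProof : {Var : Set} → RuleSet Var →
                Pred (Formula Var) ℓ → Formula Var → Set ℓ
CircularProof R H A = Σ (PreProof R) λ Π → ∃[ F ] Witnesses Π F H A

{-# OPTIONS --safe #-}

-- Fix an assignment α.  Every instance of a rule of ℛ has as many premises
-- falsified by α as conclusions falsified by α, so the balances of the falsified
-- formula-vertices add up to 0 (each inference-vertex contributes its flow times
-- the difference of these two numbers).  If α satisfies the hypotheses, then no
-- falsified vertex is a source; if it falsified the goal, then one of them would
-- be a sink and the sum would be positive.

module Submission where

open import Defs
open import Data.Bool.Base using (Bool; true; false; if_then_else_; not)
open import Data.Bool.Properties using (not-involutive)
open import Data.List.Base using (List; []; _∷_; map; foldr; filterᵇ; allFin)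
open import Data.List.Membership.Propositional using () renaming (_∈_ to _∈ₗ_)
open import Data.List.Membership.Propositional.Properties using (∈-allFin)
open import Data.List.Properties using (map-∘)
import Data.List.Relation.Binary.Permutation.Setoid.Properties as Permutation
open import Data.List.Relation.Unary.Any using (here; there)
import Data.Nat.Base as ℕ
import Data.Nat.Properties as ℕ
open import Data.Product.Base using (∃-syntax; _×_; _,_)
open import Data.Rational.Base using (ℚ; 0ℚ; ½; ∣_∣; _+_; _-_; -_; _*_; _≤_; _<_)
open import Data.Rational.Properties
open import Data.Rational.Solver using (module +-*-Solver)
open import Data.Sum.Base using (inj₁; inj₂)
open import Function.Base using (_∘_)
open import Level using (Level)
open import Relation.Binary.PropositionalEquality
  using (_≡_; refl; sym; trans; cong; cong₂; subst; subst₂; setoid; module ≡-Reasoning)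
open import Relation.Nullary using (¬_; yes; no; contradiction)
open import Relation.Unary using (Pred; _∈_)

open +-*-Solver using (solve; _:=_; _:+_; _:-_; con)

private variable
  a b : Level
  X : Set a
  Y : Set b

-- Finite sums of rationals.

∑ : List X → (X → ℚ) → ℚ
∑ xs f = foldr _+_ 0ℚ (map f xs)

∑-cong : {f g : X → ℚ} (xs : List X) → (∀ x → f x ≡ g x) → ∑ xs f ≡ ∑ xs g
∑-cong []       f≗g = refl
∑-cong (x ∷ xs) f≗g = cong₂ _+_ (f≗g x) (∑-cong xs f≗g)

∑-zero : (xs : List X) → ∑ xs (λ _ → 0ℚ) ≡ 0ℚ
∑-zero []       = refl
∑-zero (x ∷ xs) = trans (+-identityˡ _) (∑-zero xs)

∑-distrib-+ : (xs : List X) (f g : X → ℚ) →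
              ∑ xs (λ x → f x + g x) ≡ ∑ xs f + ∑ xs g
∑-distrib-+ []       f g = refl
∑-distrib-+ (x ∷ xs) f g = trans
  (cong (f x + g x +_) (∑-distrib-+ xs f g))
  (solve 4 (λ p q r s → (p :+ q) :+ (r :+ s) := (p :+ r) :+ (q :+ s)) refl
     (f x) (g x) (∑ xs f) (∑ xs g))

∑-distrib-neg : (xs : List X) (f : X → ℚ) → ∑ xs (-_ ∘ f) ≡ - ∑ xs f
∑-distrib-neg []       f = refl
∑-distrib-neg (x ∷ xs) f = trans
  (cong (- f x +_) (∑-distrib-neg xs f))
  (sym (neg-distrib-+ (f x) (∑ xs f)))

∑-comm : (xs : List X) (ys : List Y) (f : X → Y → ℚ) →
         ∑ xs (λ x → ∑ ys (f x)) ≡ ∑ ys (λ y → ∑ xs (λ x → f x y))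
∑-comm []       ys f = sym (∑-zero ys)
∑-comm (x ∷ xs) ys f = trans
  (cong (∑ ys (f x) +_) (∑-comm xs ys f))
  (sym (∑-distrib-+ ys (f x) (λ y → ∑ xs (λ z → f z y))))

∑-filterᵇ : (p : X → Bool) (xs : List X) (f : X → ℚ) →
            ∑ (filterᵇ p xs) f ≡ ∑ xs (λ x → if p x then f x else 0ℚ)
∑-filterᵇ p []       f = refl
∑-filterᵇ p (x ∷ xs) f with p x
... | true  = cong (f x +_) (∑-filterᵇ p xs f)
... | false = trans (∑-filterᵇ p xs f) (sym (+-identityˡ _))

-- Double counting of edges: padding each filtered sum with zeros makes both ranges of summation
-- fixed lists, and then the two sums commute. This passes from neighbours of formula-vertices to
-- neighbours of inference-vertices.
∑-filterᵇ-comm : (e : X → Y → Bool) (xs : List X) (ys : List Y) (f : X → Y → ℚ) →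
                 ∑ xs (λ x → ∑ (filterᵇ (e x) ys) (f x)) ≡
                 ∑ ys (λ y → ∑ (filterᵇ (λ x → e x y) xs) (λ x → f x y))
∑-filterᵇ-comm e xs ys f = begin
  ∑ xs (λ x → ∑ (filterᵇ (e x) ys) (f x))
    ≡⟨ ∑-cong xs (λ x → ∑-filterᵇ (e x) ys (f x)) ⟩
  ∑ xs (λ x → ∑ ys (λ y → if e x y then f x y else 0ℚ))
    ≡⟨ ∑-comm xs ys (λ x y → if e x y then f x y else 0ℚ) ⟩
  ∑ ys (λ y → ∑ xs (λ x → if e x y then f x y else 0ℚ))
    ≡⟨ ∑-cong ys (λ y → ∑-filterᵇ (λ x → e x y) xs (λ x → f x y)) ⟨
  ∑ ys (λ y → ∑ (filterᵇ (λ x → e x y) xs) (λ x → f x y)) ∎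
  where open ≡-Reasoning

-- Signs of Cauchy reals and of their sums.

-- Equivalent to ¬ x <ℝ 0ℝ, in a form that is constructively closed under addition.
NonNegative : ℝ → Set
NonNegative x = ∀ ε → 0ℚ < ε → ∃[ N ] ∀ n → N ℕ.≤ n → 0ℚ ≤ seq x n + ε

halve : ∀ {ε} → 0ℚ < ε → ∃[ δ ] 0ℚ < δ × δ + δ ≡ ε
halve {ε} 0<ε = ½ * ε , *-monoʳ-<-pos ½ 0<ε ,
  trans (sym (*-distribʳ-+ ε ½ ½)) (*-identityˡ ε)

p≤∣p∣ : ∀ p → p ≤ ∣ p ∣
p≤∣p∣ p with ≤-total 0ℚ p
... | inj₁ 0≤p = ≤-reflexive (sym (0≤p⇒∣p∣≡p 0≤p))
... | inj₂ p≤0 = ≤-trans p≤0 (0≤∣p∣ p)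

∣p-q∣<r⇒p<q+r : ∀ p q {r} → ∣ p - q ∣ < r → p < q + r
∣p-q∣<r⇒p<q+r p q {r} ∣p-q∣<r = subst (_< q + r)
  (solve 2 (λ p q → q :+ (p :- q) := p) refl p q)
  (+-monoʳ-< q (≤-<-trans (p≤∣p∣ (p - q)) ∣p-q∣<r))

-- A single rational comparison decides: all terms from `N` on are within `δ` of `seq x N`. If that
-- term is at least `- δ`, the later ones are at least `- (δ + δ)`; otherwise `x` would be negative.
≮0⇒nonNegative : ∀ x → ¬ x <ℝ 0ℝ → NonNegative x
≮0⇒nonNegative x x≮0 ε 0<ε
  with δ , 0<δ , δ+δ≡ε ← halve 0<ε
  with N , close ← cauchy x δ 0<δ
  with 0ℚ ≤? seq x N + δ
... | yes 0≤xN+δ = N , λ n N≤n → ≤-trans 0≤xN+δ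
        (subst (seq x N + δ ≤_)
          (trans (+-assoc (seq x n) δ δ) (cong (seq x n +_) δ+δ≡ε))
          (+-monoˡ-≤ δ (<⇒≤
            (∣p-q∣<r⇒p<q+r (seq x N) (seq x n) (close N n ℕ.≤-refl N≤n)))))
... | no 0≰xN+δ = contradiction
        -- Here `c` is negative and bounds every later term from above, so `- c` is a gap witnessing
        -- `x <ℝ 0ℝ`.
        (- c , neg-antimono-< (≰⇒> 0≰xN+δ) , N , λ n N≤n →
          subst (seq x n + - c ≤_) (+-inverseʳ c)
            (+-monoˡ-≤ (- c) (<⇒≤
              (∣p-q∣<r⇒p<q+r (seq x n) (seq x N) (close n N N≤n ℕ.≤-refl)))))
        x≮0
  where c = seq x N + δ

0-nonNegative : NonNegative 0ℝ
0-nonNegative ε 0<ε = 0 , λ _ _ → subst (0ℚ ≤_) (sym (+-identityˡ ε)) (<⇒≤ 0<ε)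

+ℝ-nonNegative : ∀ x y → NonNegative x → NonNegative y → NonNegative (x +ℝ y)
+ℝ-nonNegative x y 0≤x 0≤y ε 0<ε
  with δ , 0<δ , δ+δ≡ε ← halve 0<ε
  with M , 0≤x+δ ← 0≤x δ 0<δ
     | N , 0≤y+δ ← 0≤y δ 0<δ
  = M ℕ.⊔ N , λ n ≤n → subst (0ℚ ≤_)
      (trans
        (solve 3 (λ p q r → (p :+ r) :+ (q :+ r) := (p :+ q) :+ (r :+ r)) refl
          (seq x n) (seq y n) δ)
        (cong (seq x n + seq y n +_) δ+δ≡ε))
      (+-mono-≤ (0≤x+δ n (ℕ.m⊔n≤o⇒m≤o M N ≤n)) (0≤y+δ n (ℕ.m⊔n≤o⇒n≤o M N ≤n)))

-- One half of the gap `ε` of `x` absorbs the error allowed to `y`; the other half remains as the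
-- gap of the sum.
positive+nonNegative : ∀ x y → 0ℝ <ℝ x → NonNegative y → 0ℝ <ℝ (x +ℝ y)
positive+nonNegative x y (ε , 0<ε , M , ε≤x) 0≤y
  with δ , 0<δ , δ+δ≡ε ← halve 0<ε
  with N , 0≤y+δ ← 0≤y δ 0<δ
  = δ , 0<δ , M ℕ.⊔ N , λ n ≤n → subst₂ _≤_
      (trans
        -- The first `0ℚ` is a term of `0ℝ`, the second the lower bound on `seq y n + δ`.
        (cong (λ e → (0ℚ + e + 0ℚ) - δ) (sym δ+δ≡ε))
        (solve 1 (λ r → (con 0ℚ :+ (r :+ r) :+ con 0ℚ) :- r := con 0ℚ :+ r) refl δ))
      (solve 3 (λ p q r → (p :+ (q :+ r)) :- r := p :+ q) refl
        (seq x n) (seq y n) δ)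
      (+-monoˡ-≤ (- δ) (+-mono-≤
        (ε≤x n (ℕ.m⊔n≤o⇒m≤o M N ≤n))
        (0≤y+δ n (ℕ.m⊔n≤o⇒n≤o M N ≤n))))

nonNegative+positive : ∀ x y → NonNegative x → 0ℝ <ℝ y → 0ℝ <ℝ (x +ℝ y)
nonNegative+positive x y 0≤x 0<y =
  let ε , 0<ε , N , ε≤y+x = positive+nonNegative y x 0<y 0≤x
  in  ε , 0<ε , N , λ n N≤n →
        subst (0ℚ + ε ≤_) (+-comm (seq y n) (seq x n)) (ε≤y+x n N≤n)

sumℝ-nonNegative : (xs : List X) (f : X → ℝ) → (∀ x → NonNegative (f x)) →
                   NonNegative (sumℝ (map f xs))
sumℝ-nonNegative []       f 0≤f = 0-nonNegative
sumℝ-nonNegative (x ∷ xs) f 0≤f =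
  +ℝ-nonNegative (f x) (sumℝ (map f xs)) (0≤f x) (sumℝ-nonNegative xs f 0≤f)

sumℝ-positive : (xs : List X) (f : X → ℝ) → (∀ x → NonNegative (f x)) →
                ∀ {x} → x ∈ₗ xs → 0ℝ <ℝ f x → 0ℝ <ℝ sumℝ (map f xs)
sumℝ-positive (x ∷ xs) f 0≤f (here refl) 0<fx =
  positive+nonNegative (f x) (sumℝ (map f xs)) 0<fx (sumℝ-nonNegative xs f 0≤f)
sumℝ-positive (x ∷ xs) f 0≤f (there y∈xs) 0<fy =
  nonNegative+positive (f x) (sumℝ (map f xs)) (0≤f x) (sumℝ-positive xs f 0≤f y∈xs 0<fy)

seq-sumℝ : (xs : List X) (f : X → ℝ) (n : ℕ.ℕ) →
           seq (sumℝ (map f xs)) n ≡ ∑ xs (λ x → seq (f x) n)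
seq-sumℝ []       f n = refl
seq-sumℝ (x ∷ xs) f n = cong (seq (f x) n +_) (seq-sumℝ xs f n)

0≮ℝ-zero : ∀ x → (∀ n → seq x n ≡ 0ℚ) → ¬ 0ℝ <ℝ x
0≮ℝ-zero x x≡0 (ε , 0<ε , N , ε≤x) = <-irrefl refl (<-≤-trans 0<ε
  (subst₂ _≤_ (+-identityˡ ε) (x≡0 N) (ε≤x N ℕ.≤-refl)))

-- Falsified formulas in rule instances.

eval-dual : {Var : Set} (α : Assignment Var) (A : Formula Var) →
            eval α (dual A) ≡ not (eval α A)
eval-dual α (lit (pos _)) = refl
eval-dual α (lit (neg V)) = sym (not-involutive (α V))
eval-dual α 𝟘 = refl
eval-dual α 𝟙 = refl
eval-dual α (A ∨ B) rewrite eval-dual α A | eval-dual α B with eval α A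
... | true  = refl
... | false = refl
eval-dual α (A ∧ B) rewrite eval-dual α A | eval-dual α B with eval α A
... | true  = refl
... | false = refl

module _ {Var : Set} (α : Assignment Var) where

  -- The product of `q` with the indicator of falsity, as a conditional.
  ifFalse : ℚ → Formula Var → ℚ
  ifFalse q B = if eval α B then 0ℚ else q

  ∑-ifFalse : (xs : List X) (f : X → ℚ) (B : Formula Var) →
              ifFalse (∑ xs f) B ≡ ∑ xs (λ x → ifFalse (f x) B)
  ∑-ifFalse xs f B with eval α B
  ... | true  = sym (∑-zero xs)
  ... | false = refl

  ifFalse-minus : ∀ p q B → ifFalse (p - q) B ≡ ifFalse p B - ifFalse q B
  ifFalse-minus p q B with eval α B
  ... | true  = refl
  ... | false = refl

  -- Permutations match formulas only up to `≈`, which suffices because evaluation respects `≈`.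
  ∑-↭ : ∀ q {As Bs} → As ↭ Bs → ∑ As (ifFalse q) ≡ ∑ Bs (ifFalse q)
  ∑-↭ q As↭Bs = Permutation.foldr-commMonoid (setoid ℚ) +-0-isCommutativeMonoid
    (Permutation.map⁺ (formulaSetoid Var) (setoid ℚ)
      (λ A≈B → cong (λ v → if v then 0ℚ else q) (eval-cong α A≈B)) As↭Bs)

  open RuleSet (ℛ Var)

  -- An axiom has no premises and a true conclusion. In a cut or split, nothing is falsified if `C`
  -- is true; if `C` is false, exactly one of `C ∨ A` and `C ∨ dual A` is falsified, which matches
  -- `C`.
  rule-balanced : ∀ q (r : Instance) →
                  ∑ (conclusions r) (ifFalse q) ≡ ∑ (premises r) (ifFalse q)
  rule-balanced q (axiom A) rewrite eval-dual α A with eval α A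
  ... | true  = refl
  ... | false = refl
  rule-balanced q (symmetricCut C A) rewrite eval-dual α A with eval α C | eval α A
  ... | true  | _     = refl
  ... | false | true  = sym (+-identityˡ _)
  ... | false | false = refl
  rule-balanced q (split C A) rewrite eval-dual α A with eval α C | eval α A
  ... | true  | _     = refl
  ... | false | true  = +-identityˡ _
  ... | false | false = refl

  -- Conservation of flow through falsified vertices.

  module _ (Π : PreProof (ℛ Var)) where
    open PreProof Π

    ∑-neighbours : ∀ q (us : List J) {Bs} → map formula us ↭ Bs →
                   ∑ us (ifFalse q ∘ formula) ≡ ∑ Bs (ifFalse q)
    ∑-neighbours q us us↭Bs =
      trans (cong (foldr _+_ 0ℚ) (map-∘ us)) (∑-↭ q us↭Bs)

    -- Regrouped by inference-vertex, the left side weights each `f w` by the number of falsified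
    -- conclusions of `w`, the right side by that of falsified premises; `rule-balanced` equates
    -- them.
    falsified-in-out : (f : I → ℚ) →
      ∑ (allFin #J) (λ u → ifFalse (∑ (N⁻ᴶ u) f) (formula u)) ≡
      ∑ (allFin #J) (λ u → ifFalse (∑ (N⁺ᴶ u) f) (formula u))
    falsified-in-out f = begin
      ∑ (allFin #J) (λ u → ifFalse (∑ (N⁻ᴶ u) f) (formula u))
        ≡⟨ ∑-cong (allFin #J) (λ u → ∑-ifFalse (N⁻ᴶ u) f (formula u)) ⟩
      ∑ (allFin #J) (λ u → ∑ (N⁻ᴶ u) (λ w → ifFalse (f w) (formula u)))
        ≡⟨ ∑-filterᵇ-comm (λ u w → edgeᴵᴶ w u) (allFin #J) (allFin #I) _ ⟩
      ∑ (allFin #I) (λ w → ∑ (N⁺ᴵ w) (ifFalse (f w) ∘ formula))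
        ≡⟨ ∑-cong (allFin #I) balanced ⟩
      ∑ (allFin #I) (λ w → ∑ (N⁻ᴵ w) (ifFalse (f w) ∘ formula))
        ≡⟨ ∑-filterᵇ-comm edgeᴶᴵ (allFin #J) (allFin #I) _ ⟨
      ∑ (allFin #J) (λ u → ∑ (N⁺ᴶ u) (λ w → ifFalse (f w) (formula u)))
        ≡⟨ ∑-cong (allFin #J) (λ u → ∑-ifFalse (N⁺ᴶ u) f (formula u)) ⟨
      ∑ (allFin #J) (λ u → ifFalse (∑ (N⁺ᴶ u) f) (formula u)) ∎
      where
      open ≡-Reasoning
      balanced : ∀ w → ∑ (N⁺ᴵ w) (ifFalse (f w) ∘ formula) ≡
                       ∑ (N⁻ᴵ w) (ifFalse (f w) ∘ formula)
      balanced w = begin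
        ∑ (N⁺ᴵ w) (ifFalse (f w) ∘ formula)
          ≡⟨ ∑-neighbours (f w) (N⁺ᴵ w) (out-labels w) ⟩
        ∑ (conclusions (rule w)) (ifFalse (f w))
          ≡⟨ rule-balanced (f w) (rule w) ⟩
        ∑ (premises (rule w)) (ifFalse (f w))
          ≡⟨ ∑-neighbours (f w) (N⁻ᴵ w) (in-labels w) ⟨
        ∑ (N⁻ᴵ w) (ifFalse (f w) ∘ formula) ∎

    module _ (F : FlowAssignment Π) where
      open FlowAssignment F

      -- Satisfied vertices get `0ℝ`, so that sums can run over all of `J`.
      falsifiedBalance : J → ℝ
      falsifiedBalance u = if eval α (formula u) then 0ℝ else balance Π F u

      seq-falsifiedBalance : ∀ n u → seq (falsifiedBalance u) n ≡
        ifFalse (∑ (N⁻ᴶ u) (λ w → seq (flow w) n)) (formula u) -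
        ifFalse (∑ (N⁺ᴶ u) (λ w → seq (flow w) n)) (formula u)
      seq-falsifiedBalance n u with eval α (formula u)
      ... | true  = refl
      ... | false = cong₂ _-_ (seq-sumℝ (N⁻ᴶ u) flow n) (seq-sumℝ (N⁺ᴶ u) flow n)

      -- Real addition and negation act termwise, so conservation holds exactly at every index, with
      -- the `n`-th approximations of the flows as rational weights.
      falsifiedBalance-sum : ∀ n →
        seq (sumℝ (map falsifiedBalance (allFin #J))) n ≡ 0ℚ
      falsifiedBalance-sum n = begin
        seq (sumℝ (map falsifiedBalance us)) n
          ≡⟨ seq-sumℝ us falsifiedBalance n ⟩
        ∑ us (λ u → seq (falsifiedBalance u) n)
          ≡⟨ ∑-cong us (seq-falsifiedBalance n) ⟩
        ∑ us (λ u → in-u u - out-u u)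
          ≡⟨ ∑-distrib-+ us in-u (-_ ∘ out-u) ⟩
        ∑ us in-u + ∑ us (-_ ∘ out-u)
          ≡⟨ cong₂ _+_ (falsified-in-out f) (∑-distrib-neg us out-u) ⟩
        ∑ us out-u - ∑ us out-u
          ≡⟨ +-inverseʳ (∑ us out-u) ⟩
        0ℚ ∎
        where
        open ≡-Reasoning
        us = allFin #J
        f : I → ℚ
        f w = seq (flow w) n
        in-u out-u : J → ℚ
        in-u  u = ifFalse (∑ (N⁻ᴶ u) f) (formula u)
        out-u u = ifFalse (∑ (N⁺ᴶ u) f) (formula u)

      no-falsified-sink : (∀ u → IsSource Π F u → α ⊨ formula u) →
                          ∀ u → IsSink Π F u → α ⊨ formula u
      no-falsified-sink sources⊨ u sink with eval α (formula u) in falsified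
      ... | true  = refl
      -- A falsified sink would be a positive summand among nonnegative ones, in a sum whose terms
      -- all vanish.
      ... | false = contradiction
        (sumℝ-positive (allFin #J) falsifiedBalance nonNegative (∈-allFin u)
          (subst (λ v → 0ℝ <ℝ (if v then 0ℝ else balance Π F u)) (sym falsified) sink))
        (0≮ℝ-zero (sumℝ (map falsifiedBalance (allFin #J))) falsifiedBalance-sum)
        where
        nonNegative : ∀ v → NonNegative (falsifiedBalance v)
        -- Abstracting `sources⊨ v` together with the truth value turns it, in the falsified case,
        -- into a refutation of `v` being a source.
        nonNegative v with eval α (formula v) | sources⊨ v
        ... | true  | _    = 0-nonNegative
        ... | false | v⊨   = ≮0⇒nonNegative (balance Π F v)
          (λ source → contradiction (v⊨ source) λ ())

theorem1 : ∀ {ℓ : Level} {Var : Set} (H : Pred (Formula Var) ℓ) (A : Formula Var) →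
    CircularProof (ℛ Var) H A →
    ∀ (α : Assignment Var) → (∀ B → B ∈ H → α ⊨ B) → α ⊨ A
theorem1 H A (Π , F , sources , u , sink , u≈A) α α⊨H =
  -- The sink carries the goal only up to `≈`, as the sources do the hypotheses; `eval-cong` bridges
  -- both.
  trans (sym (eval-cong α u≈A)) (no-falsified-sink α Π F sources⊨ u sink)
  where
  sources⊨ : ∀ v → IsSource Π F v → α ⊨ PreProof.formula Π v
  sources⊨ v source with B , B∈H , v≈B ← sources v source =
    trans (eval-cong α v≈B) (α⊨H B B∈H)
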